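{- Let $a=(\Sigma,\vdash)$ and $a'=(\Sigma',\vdash')$ be Lindenbaum algebraizable logics and let $\mathbb{G}=(h:a\to a',\bar\rho)$ be a Glivenko's context, with lifting $\rho_X:F(\Sigma')(X)\to F(\Sigma)(X)$ of $\bar\rho_X$. Then for every $\Gamma'\cup\{\varphi'\}\subseteq F(\Sigma')(X)$, $$\rho_X[\Gamma']\vdash\rho_X(\varphi')\iff\Gamma'\vdash'\varphi'.$$
   Context: **Logics.** A signature is a sequence $\Sigma=(\Sigma_n)_{n\in\mathbb{N}}$ of pairwise disjoint sets ($\Sigma_n$: the $n$-ary connectives). $X=\{x_0,x_1,\dots\}$ is a fixed countable set of variables, $F(\Sigma)=F(\Sigma)(X)$ is the absolutely free $\Sigma$-algebra (set of formulas) on $X$, and $F(\Sigma)[n]$ is the set of formulas whose variables are exactly $x_0,\dots,x_{n-1}$. A logic is a pair $a=(\Sigma,\vdash)$ with $\vdash\subseteq\mathcal P(F(\Sigma))\times F(\Sigma)$ a reflexive, monotone, finitary, structural (substitution-invariant) relation satisfying cut. A flexible morphism $f:\Sigma\to\Sigma'$ is a family of functions $\Sigma_n\to F(\Sigma')[n]$; it extends to $\check f:F(\Sigma)\to F(\Sigma')$ by $\check f(x)=x$ for $x\in X$ and $\check f(c_n(\psi_0,\dots,\psi_{n-1}))=f(c_n)[x_0|\check f(\psi_0),\dots,x_{n-1}|\check f(\psi_{n-1})]$. A flexible translation $f:(\Sigma,\vdash)\to(\Sigma',\vdash')$ is a flexible morphism such that $\Gamma\vdash\psi$ implies $\check f[\Gamma]\vdash'\check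 f(\psi)$. **Algebraizable logics** (Blok–Pigozzi). For a class $K$ of $\Sigma$-algebras, $\models_K$ is the equational consequence of $K$. A logic $a=(\Sigma,\vdash)$ is algebraizable if there are a class $K$, a finite set $\tau(p)=\{(\varepsilon^j(p),\delta^j(p))\}_{j}$ of equations in one variable and a finite set $\Delta(p,q)$ of formulas in two variables such that $\Gamma\vdash\varphi$ iff $\bigcup_{\gamma\in\Gamma}\tau(\gamma)\models_K\tau(\varphi)$, and $\varphi\equiv\psi$ is interderivable under $\models_K$ with $\tau(\varphi\Delta\psi)$. Then $(\tau,\Delta)$ is an algebraizing pair, and there is a unique quasivariety $QV(a)$ that can serve as $K$. $\varphi/\Delta=[\varphi]=\{\psi:\ \vdash\varphi\Delta\psi\}$ (independent of the choice of $\Delta$); $F(\Sigma)/\Delta$ is the free $QV(a)$-algebra on $X$. An algebraizable logic is Lindenbaum algebraizable if $\varphi\dashv\vdash\psi\iff\ \vdash\varphi\Delta\psi$ for all formulas $\varphi,\psi$. $\mathcal A_f$ is the category of algebraizable logics and flexible translations preserving algebraizing pairs, i.e. sending an algebraizing pair $(\tau,\Delta)$ of the source to an algebraizing pair $(\check f(\tau),\check f(\Delta))$ of the target. **Functors on algebras.** For $h:a\to a'$ in $\mathcal A_f$ and a $\Sigma'$-algebra $M$, $h^\star(M)$ is the $\Sigma$-algebra on the same set with $c_n^{h^\star(M)}=h(c_n)^M$, and $h^\star$ is the identity on maps. It restricts to $h^\star{\restriction}:QV(a')\to QV(a)$, which has a left adjoint, written $L_h:QV(a)\to QV(a')$, with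 unit $\bar\partial:Id\Rightarrow h^\star{\restriction}\circ L_h$. One identifies $L_h(F(\Sigma)/\Delta)$ with $F(\Sigma')/\Delta'$, so that the unit at $F(\Sigma)/\Delta$ is $\bar\partial_X:F(\Sigma)/\Delta\to h^\star(F(\Sigma')/\Delta')$, $[\theta]\mapsto[\check h(\theta)]$. **Glivenko's context.** A pair $\mathbb{G}=(h:a\to a',\bar\rho)$ with $h\in\mathcal A_f(a,a')$ and $\bar\rho:h^\star{\restriction}\circ L_h\Rightarrow Id$ a natural transformation (of endofunctors of $QV(a)$) which is a section of the unit: $\bar\partial_M\circ\bar\rho_M=id$ for all $M\in QV(a)$. Write $\bar\rho_X:h^\star(F(\Sigma')/\Delta')\to F(\Sigma)/\Delta$ for its component at $F(\Sigma)/\Delta$. A lifting $\rho_X:F(\Sigma')(X)\to F(\Sigma)(X)$ of $\bar\rho_X$ is any (chosen) function with $[\rho_X(\theta')]=\bar\rho_X([\theta'])$ for all $\theta'\in F(\Sigma')(X)$. -}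

module Defs where

open import Data.Fin using (Fin; zero; suc)
open import Data.List using (List; []; _∷_; concatMap)
import Data.List as List
open import Data.List.Membership.Propositional using () renaming (_∈_ to _∈ˡ_)
open import Data.List.Membership.Propositional.Properties
  using (∈-map⁺; ∈-map⁻; ∈-concatMap⁺; ∈-concatMap⁻)
open import Data.List.Membership.Propositional using (find; lose)
open import Data.List.Relation.Unary.All using (All; []; _∷_)
import Data.List.Relation.Unary.All as All
open import Data.List.Relation.Unary.Any using (here; there)
open import Data.Nat using (ℕ)
open import Data.Product using (Σ; Σ-syntax; ∃; ∃-syntax; _×_; _,_; proj₁; proj₂)
open import Data.Vec using (Vec; []; _∷_; lookup; map)
open import Data.Vec.Properties using (lookup-map)
open import Data.Vec.Relation.Binary.Pointwise.Inductive using (Pointwise; []; _∷_)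
import Data.Vec.Relation.Binary.Pointwise.Inductive as Pw
open import Data.Vec.Relation.Unary.Any using () renaming (Any to Anyᵛ)
open import Function.Bundles using (_⇔_; mk⇔; Equivalence)
open import Level using (Level; _⊔_) renaming (suc to lsuc)
open import Relation.Binary.Bundles using (Setoid)
open import Relation.Binary.PropositionalEquality
  using (_≡_; refl; sym; trans; cong; cong₂; subst)
open import Relation.Binary.Structures using (IsEquivalence)
open import Relation.Unary using (Pred; _∈_; _⊆_; _≐_; ｛_｝)
open import Relation.Unary.Polymorphic using (∅)
import Relation.Binary.Reasoning.Setoid as SetoidReasoning

-- S n is the set of n-ary connectives; indexing makes the S n disjoint.
Signature : (ℓ : Level) → Set (lsuc ℓ)
Signature ℓ = ℕ → Set ℓ

data Term {ℓ} (S : Signature ℓ) (V : Set) : Set ℓ where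
  var : V → Term S V
  op  : ∀ {n} → S n → Vec (Term S V) n → Term S V

Formula : ∀ {ℓ} → Signature ℓ → Set ℓ
Formula S = Term S ℕ

module _ {ℓ} {S : Signature ℓ} {V W : Set} where

  sub  : (V → Term S W) → Term S V → Term S W
  subs : ∀ {n} → (V → Term S W) → Vec (Term S V) n → Vec (Term S W) n

  sub σ (var x)   = σ x
  sub σ (op c ts) = op c (subs σ ts)

  subs σ []       = []
  subs σ (t ∷ ts) = sub σ t ∷ subs σ ts

data _occursIn_ {ℓ} {S : Signature ℓ} {V : Set} (x : V) : Term S V → Set ℓ where
  here  : x occursIn var x
  there : ∀ {n} {c : S n} {ts : Vec (Term S V) n} →
          Anyᵛ (x occursIn_) ts → x occursIn op c ts

-- Formulas whose variables are exactly x₀, …, xₙ₋₁: the type Fin n of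
-- variables gives "at most", the second component "at least".
Formula[_] : ∀ {ℓ} → ℕ → Signature ℓ → Set ℓ
Formula[ n ] S = Σ[ t ∈ Term S (Fin n) ] (∀ i → i occursIn t)

FlexibleMorphism : ∀ {ℓ} → Signature ℓ → Signature ℓ → Set ℓ
FlexibleMorphism S S′ = ∀ {n} → S n → Formula[ n ] S′

-- The extension f ↦ f̌, on terms over any set of variables.
module _ {ℓ} {S S′ : Signature ℓ} (f : FlexibleMorphism S S′) {V : Set} where

  ext  : Term S V → Term S′ V
  exts : ∀ {n} → Vec (Term S V) n → Vec (Term S′ V) n

  ext (var x)   = var x
  ext (op c ts) = sub (lookup (exts ts)) (proj₁ (f c))

  exts []       = []
  exts (t ∷ ts) = ext t ∷ exts ts

image : ∀ {ℓ} {A B : Set ℓ} → (A → B) → Pred A ℓ → Pred B ℓ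
image f Γ b = ∃[ a ] a ∈ Γ × b ≡ f a

module _ {ℓ} {S : Signature ℓ} {V W : Set} where

  sub-cong  : {σ σ′ : V → Term S W} → (∀ x → σ x ≡ σ′ x) →
              ∀ t → sub σ t ≡ sub σ′ t
  subs-cong : {σ σ′ : V → Term S W} → (∀ x → σ x ≡ σ′ x) →
              ∀ {n} (ts : Vec (Term S V) n) → subs σ ts ≡ subs σ′ ts

  sub-cong eq (var x)   = eq x
  sub-cong eq (op c ts) = cong (op c) (subs-cong eq ts)

  subs-cong eq []       = refl
  subs-cong eq (t ∷ ts) = cong₂ _∷_ (sub-cong eq t) (subs-cong eq ts)

  lookup-subs : (σ : V → Term S W) → ∀ {n} (ts : Vec (Term S V) n) i →
                lookup (subs σ ts) i ≡ sub σ (lookup ts i)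
  lookup-subs σ (t ∷ ts) zero    = refl
  lookup-subs σ (t ∷ ts) (suc i) = lookup-subs σ ts i

module _ {ℓ} {S : Signature ℓ} {U V W : Set}
         (σ : V → Term S W) (ρ : U → Term S V) where

  sub-sub  : ∀ t → sub σ (sub ρ t) ≡ sub (λ x → sub σ (ρ x)) t
  subs-subs : ∀ {n} (ts : Vec (Term S U) n) →
              subs σ (subs ρ ts) ≡ subs (λ x → sub σ (ρ x)) ts

  sub-sub (var x)   = refl
  sub-sub (op c ts) = cong (op c) (subs-subs ts)

  subs-subs []       = refl
  subs-subs (t ∷ ts) = cong₂ _∷_ (sub-sub t) (subs-subs ts)

module _ {ℓ} {S S′ : Signature ℓ} (f : FlexibleMorphism S S′) where

  exts≡map : ∀ {V n} (ts : Vec (Term S V) n) → exts f ts ≡ map (ext f) ts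
  exts≡map []       = refl
  exts≡map (t ∷ ts) = cong (ext f t ∷_) (exts≡map ts)

  module _ {V W : Set} (σ : V → Term S W) where

    ext-sub  : ∀ t → ext f (sub σ t) ≡ sub (λ x → ext f (σ x)) (ext f t)
    exts-subs : ∀ {n} (ts : Vec (Term S V) n) →
                exts f (subs σ ts) ≡ subs (λ x → ext f (σ x)) (exts f ts)

    ext-sub (var x)   = refl
    ext-sub (op c ts) = trans
      (sub-cong (λ i → trans (cong (λ us → lookup us i) (exts-subs ts))
                             (lookup-subs _ (exts f ts) i))
                (proj₁ (f c)))
      (sym (sub-sub _ _ (proj₁ (f c))))

    exts-subs []       = refl
    exts-subs (t ∷ ts) = cong₂ _∷_ (ext-sub t) (exts-subs ts)

record Logic {ℓ} (S : Signature ℓ) : Set (lsuc ℓ) where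
  infix 4 _⊢_
  field
    _⊢_        : Pred (Formula S) ℓ → Formula S → Set ℓ
    reflexive  : ∀ {Γ φ} → φ ∈ Γ → Γ ⊢ φ
    monotone   : ∀ {Γ Γ′ φ} → Γ ⊆ Γ′ → Γ ⊢ φ → Γ′ ⊢ φ
    cut        : ∀ {Γ Γ′ φ} → (∀ {ψ} → ψ ∈ Γ′ → Γ ⊢ ψ) → Γ′ ⊢ φ → Γ ⊢ φ
    finitary   : ∀ {Γ φ} → Γ ⊢ φ → ∃[ Φ ] All Γ Φ × ((_∈ˡ Φ) ⊢ φ)
    structural : ∀ {Γ φ} (σ : ℕ → Formula S) →
                 Γ ⊢ φ → image (sub σ) Γ ⊢ sub σ φ

IsTranslation : ∀ {ℓ} {S S′ : Signature ℓ} → Logic S → Logic S′ →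
                FlexibleMorphism S S′ → Set (lsuc ℓ)
IsTranslation a a′ f =
  ∀ {Γ φ} → Logic._⊢_ a Γ φ → Logic._⊢_ a′ (image (ext f) Γ) (ext f φ)

-- In the absence of quotient types carriers are setoids, and homomorphisms are
-- compared pointwise up to setoid equality.  Carriers may be empty.
record Algebra {ℓ} (S : Signature ℓ) : Set (lsuc ℓ) where
  field
    setoid : Setoid ℓ ℓ
  open Setoid setoid public
    renaming (refl to ≈-refl; sym to ≈-sym; trans to ≈-trans;
              reflexive to ≈-reflexive)
  field
    interp      : ∀ {n} → S n → Vec Carrier n → Carrier
    interp-cong : ∀ {n} (c : S n) {as bs : Vec Carrier n} →
                  Pointwise _≈_ as bs → interp c as ≈ interp c bs

  module _ {V : Set} where

    eval  : (V → Carrier) → Term S V → Carrier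
    evals : ∀ {n} → (V → Carrier) → Vec (Term S V) n → Vec Carrier n

    eval v (var x)   = v x
    eval v (op c ts) = interp c (evals v ts)

    evals v []       = []
    evals v (t ∷ ts) = eval v t ∷ evals v ts

    eval-cong  : {v w : V → Carrier} → (∀ x → v x ≈ w x) →
                 ∀ t → eval v t ≈ eval w t
    evals-cong : {v w : V → Carrier} → (∀ x → v x ≈ w x) →
                 ∀ {n} (ts : Vec (Term S V) n) →
                 Pointwise _≈_ (evals v ts) (evals w ts)

    eval-cong eq (var x)   = eq x
    eval-cong eq (op c ts) = interp-cong c (evals-cong eq ts)

    evals-cong eq []       = []
    evals-cong eq (t ∷ ts) = eval-cong eq t ∷ evals-cong eq ts

  module _ {V W : Set} (v : W → Carrier) (σ : V → Term S W) where

    eval-sub  : ∀ t → eval v (sub σ t) ≡ eval (λ x → eval v (σ x)) t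
    evals-subs : ∀ {n} (ts : Vec (Term S V) n) →
                 evals v (subs σ ts) ≡ evals (λ x → eval v (σ x)) ts

    eval-sub (var x)   = refl
    eval-sub (op c ts) = cong (interp c) (evals-subs ts)

    evals-subs []       = refl
    evals-subs (t ∷ ts) = cong₂ _∷_ (eval-sub t) (evals-subs ts)

record Hom {ℓ} {S : Signature ℓ} (M N : Algebra S) : Set ℓ where
  private
    module M = Algebra M
    module N = Algebra N
  field
    fun      : M.Carrier → N.Carrier
    fun-cong : ∀ {x y} → x M.≈ y → fun x N.≈ fun y
    fun-op   : ∀ {n} (c : S n) as →
               fun (M.interp c as) N.≈ N.interp c (map fun as)

  fun-eval  : ∀ {V : Set} (v : V → M.Carrier) t →
              fun (M.eval v t) N.≈ N.eval (λ x → fun (v x)) t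
  fun-evals : ∀ {V : Set} (v : V → M.Carrier) {n} (ts : Vec (Term S V) n) →
              Pointwise N._≈_ (map fun (M.evals v ts))
                              (N.evals (λ x → fun (v x)) ts)

  fun-eval v (var x)   = N.≈-refl
  fun-eval v (op c ts) =
    N.≈-trans (fun-op c _) (N.interp-cong c (fun-evals v ts))

  fun-evals v []       = []
  fun-evals v (t ∷ ts) = fun-eval v t ∷ fun-evals v ts

open Hom using (fun)

idHom : ∀ {ℓ} {S : Signature ℓ} {M : Algebra S} → Hom M M
idHom {M = M} = record
  { fun = λ x → x
  ; fun-cong = λ p → p
  ; fun-op = λ c as → interp-cong c
      (Pw.map ≈-reflexive (Pw.≡⇒Pointwise-≡ (sym (map-id as))))
  }
  where open Algebra M
        open import Data.Vec.Properties using (map-id)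

compHom : ∀ {ℓ} {S : Signature ℓ} {M N P : Algebra S} →
          Hom N P → Hom M N → Hom M P
compHom {P = P} g f = record
  { fun = λ x → fun g (fun f x)
  ; fun-cong = λ p → Hom.fun-cong g (Hom.fun-cong f p)
  ; fun-op = λ c as → ≈-trans (Hom.fun-cong g (Hom.fun-op f c as))
      (≈-trans (Hom.fun-op g c _) (interp-cong c
        (Pw.map ≈-reflexive (Pw.≡⇒Pointwise-≡ (sym (map-∘ (fun g) (fun f) as))))))
  }
  where open Algebra P
        open import Data.Vec.Properties using (map-∘)

module _ {ℓ} {S S′ : Signature ℓ} (h : FlexibleMorphism S S′) where

  infix 8 _⋆_
  _⋆_ : Algebra S′ → Algebra S
  _⋆_ M = record
    { setoid      = setoid
    ; interp      = λ c as → eval (lookup as) (proj₁ (h c))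
    ; interp-cong = λ c ps → eval-cong (Pw.lookup ps) (proj₁ (h c))
    }
    where open Algebra M

  ⋆-hom : {M N : Algebra S′} → Hom M N → Hom (_⋆_ M) (_⋆_ N)
  ⋆-hom {N = N} g = record
    { fun      = fun g
    ; fun-cong = Hom.fun-cong g
    ; fun-op   = λ c as → ≈-trans (Hom.fun-eval g _ (proj₁ (h c)))
        (eval-cong (λ i → ≈-reflexive (sym (lookup-map i (fun g) as)))
                   (proj₁ (h c)))
    }
    where open Algebra N

  module _ (N : Algebra S′) {V : Set} (v : V → Algebra.Carrier N) where
    private
      module N  = Algebra N
      module hN = Algebra (_⋆_ N)

    eval-ext : ∀ t → N.eval v (ext h t) N.≈ hN.eval v t
    evals-exts : ∀ {n} (ts : Vec (Term S V) n) i →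
                 N.eval v (lookup (exts h ts) i) N.≈ lookup (hN.evals v ts) i

    eval-ext (var x)   = N.≈-refl
    eval-ext (op c ts) = N.≈-trans
      (N.≈-reflexive (N.eval-sub v (lookup (exts h ts)) (proj₁ (h c))))
      (N.eval-cong (evals-exts ts) (proj₁ (h c)))

    evals-exts (t ∷ ts) zero    = eval-ext t
    evals-exts (t ∷ ts) (suc i) = evals-exts ts i

Equation : ∀ {ℓ} → Signature ℓ → Set → Set ℓ
Equation S V = Term S V × Term S V

Class : ∀ {ℓ} → Signature ℓ → Set (lsuc (lsuc ℓ))
Class {ℓ} S = Pred (Algebra S) (lsuc ℓ)

-- (premises , conclusion), read as: the conjunction of the premises implies the
-- conclusion.
QuasiIdentity : ∀ {ℓ} → Signature ℓ → Set ℓ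
QuasiIdentity S = List (Equation S ℕ) × Equation S ℕ

module _ {ℓ} {S : Signature ℓ} where

  Satisfies : (M : Algebra S) → (ℕ → Algebra.Carrier M) → Equation S ℕ → Set ℓ
  Satisfies M v (s , t) = eval v s ≈ eval v t
    where open Algebra M

  infix 4 _⊨[_]_
  _⊨[_]_ : Pred (Equation S ℕ) ℓ → Class S → Equation S ℕ → Set (lsuc ℓ)
  E ⊨[ K ] e = ∀ M → K M → ∀ v → (∀ {e′} → e′ ∈ E → Satisfies M v e′) →
               Satisfies M v e

  _⊨qi_ : Algebra S → QuasiIdentity S → Set ℓ
  M ⊨qi (es , e) = ∀ v → All (Satisfies M v) es → Satisfies M v e

  Models : Pred (QuasiIdentity S) (lsuc ℓ) → Class S
  Models Ax M = ∀ q → q ∈ Ax → M ⊨qi q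

  IsQuasivariety : Class S → Set (lsuc (lsuc ℓ))
  IsQuasivariety K = ∃[ Ax ] K ≐ Models Ax

  Validated : Class S → Pred (QuasiIdentity S) (lsuc ℓ)
  Validated K q = ∀ M → K M → M ⊨qi q

  generatedQV : Class S → Class S
  generatedQV K = Models (Validated K)

-- τ(p) and Δ(p, q), with p = 0 in Fin 1 and p = 0, q = 1 in Fin 2.
record TranslationPair {ℓ} (S : Signature ℓ) : Set ℓ where
  field
    τ : List (Equation S (Fin 1))
    Δ : List (Term S (Fin 2))

  τ[_] : Formula S → List (Equation S ℕ)
  τ[ φ ] = List.map (λ (ε , δ) → sub (λ _ → φ) ε , sub (λ _ → φ) δ) τ

  _Δ[]_ : Formula S → Formula S → List (Formula S)
  φ Δ[] ψ = List.map (sub (lookup (φ ∷ ψ ∷ []))) Δ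

  -- ⋃_{γ ∈ Γ} τ(γ)
  τ⟦_⟧ : Pred (Formula S) ℓ → Pred (Equation S ℕ) ℓ
  τ⟦ Γ ⟧ e = ∃[ γ ] γ ∈ Γ × e ∈ˡ τ[ γ ]

record Algebraizes {ℓ} {S : Signature ℓ} (a : Logic S) (K : Class S)
                   (p : TranslationPair S) : Set (lsuc ℓ) where
  open Logic a
  open TranslationPair p
  field
    logic⇔eq : ∀ {Γ φ} → Γ ⊢ φ ⇔ All (τ⟦ Γ ⟧ ⊨[ K ]_) τ[ φ ]
    eq⊨τΔ    : ∀ {φ ψ e} → e ∈ τ⟦ _∈ˡ (φ Δ[] ψ) ⟧ → ｛ φ , ψ ｝ ⊨[ K ] e
    τΔ⊨eq    : ∀ {φ ψ} → τ⟦ _∈ˡ (φ Δ[] ψ) ⟧ ⊨[ K ] (φ , ψ)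

IsAlgebraizingPair : ∀ {ℓ} {S : Signature ℓ} →
                     Logic S → TranslationPair S → Set (lsuc (lsuc ℓ))
IsAlgebraizingPair a p = ∃[ K ] Algebraizes a K p

module _ {ℓ} {S : Signature ℓ} {a : Logic S} {K : Class S}
         {p : TranslationPair S} (alg : Algebraizes a K p) where
  open Logic a
  open TranslationPair p
  open Algebraizes alg

  Δ⟦_⟧ : Pred (Equation S ℕ) ℓ → Pred (Formula S) ℓ
  Δ⟦ E ⟧ χ = ∃[ e ] e ∈ E × χ ∈ˡ (proj₁ e Δ[] proj₂ e)

  eqs⇒Δ : ∀ {E φ ψ} → E ⊨[ K ] (φ , ψ) → All (Δ⟦ E ⟧ ⊢_) (φ Δ[] ψ)
  eqs⇒Δ E⊨ = All.tabulate λ χ∈ → Equivalence.from logic⇔eq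
    (All.tabulate λ e∈ M KM v sat →
      eq⊨τΔ (_ , χ∈ , e∈) M KM v λ { refl →
        E⊨ M KM v λ e′∈ → τΔ⊨eq M KM v λ (_ , χ′∈ , e″∈) →
          sat (_ , (_ , e′∈ , χ′∈) , e″∈) })

  Δ⇒eqs : ∀ {E φ ψ} → All (Δ⟦ E ⟧ ⊢_) (φ Δ[] ψ) → E ⊨[ K ] (φ , ψ)
  Δ⇒eqs ⊢Δ M KM v sat = τΔ⊨eq M KM v λ (_ , χ∈ , e∈) →
    All.lookup (Equivalence.to logic⇔eq (All.lookup ⊢Δ χ∈)) e∈ M KM v
      λ { (_ , (_ , e′∈ , χ′∈) , e″∈) →
        eq⊨τΔ (_ , χ′∈ , e″∈) M KM v λ { refl → sat e′∈ } }

  ⊢Δ⇒τ⊨ : ∀ {T φ ψ} → All (T ⊢_) (φ Δ[] ψ) → τ⟦ T ⟧ ⊨[ K ] (φ , ψ)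
  ⊢Δ⇒τ⊨ T⊢ M KM v sat = τΔ⊨eq M KM v λ (_ , χ∈ , e∈) →
    All.lookup (Equivalence.to logic⇔eq (All.lookup T⊢ χ∈)) e∈ M KM v sat

  τ⊨⇒⊢Δ : ∀ {T φ ψ} → τ⟦ T ⟧ ⊨[ K ] (φ , ψ) → All (T ⊢_) (φ Δ[] ψ)
  τ⊨⇒⊢Δ T⊨ = All.tabulate λ χ∈ → Equivalence.from logic⇔eq
    (All.tabulate λ e∈ M KM v sat →
      eq⊨τΔ (_ , χ∈ , e∈) M KM v λ { refl → T⊨ M KM v sat })

module _ {ℓ} {S : Signature ℓ} {a : Logic S} {K₁ K₂ : Class S}
         {p₁ p₂ : TranslationPair S}
         (alg₁ : Algebraizes a K₁ p₁) (alg₂ : Algebraizes a K₂ p₂) where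
  open Logic a
  private
    module P₁ = TranslationPair p₁
    module P₂ = TranslationPair p₂

  Δ-independent : ∀ {T φ ψ} → All (T ⊢_) (φ P₁.Δ[] ψ) → All (T ⊢_) (φ P₂.Δ[] ψ)
  Δ-independent {T} {φ} {ψ} T⊢ = All.tabulate λ χ∈ → go χ∈
    where
    eq : P₁.τ⟦ T ⟧ ⊨[ K₁ ] (φ , ψ)
    eq = ⊢Δ⇒τ⊨ alg₁ T⊢

    go : ∀ {χ} → χ ∈ˡ (φ P₂.Δ[] ψ) → T ⊢ χ
    go χ∈ with ∈-map⁻ _ χ∈
    ... | δ , δ∈ , refl = Equivalence.from (Algebraizes.logic⇔eq alg₁)
      (All.tabulate λ e∈ M KM v sat → step e∈ M KM v sat)
      where
      ⊢δφφ : T ⊢ sub (lookup (φ ∷ φ ∷ [])) δ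
      ⊢δφφ = All.lookup
        (τ⊨⇒⊢Δ alg₂ {T = T} (λ M _ _ _ → Algebra.≈-refl M)) (∈-map⁺ _ δ∈)

      step : ∀ {e} → e ∈ˡ P₁.τ[ sub (lookup (φ ∷ ψ ∷ [])) δ ] →
             P₁.τ⟦ T ⟧ ⊨[ K₁ ] e
      step e∈ M KM v sat with ∈-map⁻ _ e∈
      ... | (ε , δ′) , ε∈ , refl = begin
          eval v (sub (λ _ → δφψ) ε)   ≈⟨ swap ε ⟨
          eval v (sub (λ _ → δφφ) ε)   ≈⟨ All.lookup
                                            (Equivalence.to (Algebraizes.logic⇔eq alg₁) ⊢δφφ)
                                            (∈-map⁺ _ ε∈) M KM v sat ⟩
          eval v (sub (λ _ → δφφ) δ′)  ≈⟨ swap δ′ ⟩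
          eval v (sub (λ _ → δφψ) δ′)  ∎
        where
        open Algebra M
        open SetoidReasoning setoid
        δφφ δφψ : Formula S
        δφφ = sub (lookup (φ ∷ φ ∷ [])) δ
        δφψ = sub (lookup (φ ∷ ψ ∷ [])) δ

        pointwise : ∀ i → eval v (lookup (φ ∷ φ ∷ []) i) ≈
                          eval v (lookup (φ ∷ ψ ∷ []) i)
        pointwise zero       = ≈-refl
        pointwise (suc zero) = eq M KM v sat

        φφ≈φψ : eval v δφφ ≈ eval v δφψ
        φφ≈φψ = begin
          eval v δφφ  ≡⟨ eval-sub v _ δ ⟩
          _           ≈⟨ eval-cong pointwise δ ⟩
          _           ≡⟨ eval-sub v _ δ ⟨
          eval v δφψ  ∎

        swap : ∀ t → eval v (sub (λ _ → δφφ) t) ≈ eval v (sub (λ _ → δφψ) t)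
        swap t = begin
          _  ≡⟨ eval-sub v _ t ⟩
          _  ≈⟨ eval-cong (λ _ → φφ≈φψ) t ⟩
          _  ≡⟨ eval-sub v _ t ⟨
          _  ∎

module _ {ℓ} {S : Signature ℓ} {a : Logic S} {K₁ K₂ : Class S}
         {p₁ p₂ : TranslationPair S}
         (alg₁ : Algebraizes a K₁ p₁) (alg₂ : Algebraizes a K₂ p₂) where
  open Logic a

  ⊨-independent : ∀ {E φ ψ} → E ⊨[ K₁ ] (φ , ψ) → E ⊨[ K₂ ] (φ , ψ)
  ⊨-independent {E} {φ} {ψ} E⊨ = Δ⇒eqs alg₂ {E} {φ} {ψ} (All.map
    (cut λ (_ , e∈ , χ∈) → All.lookup
      (Δ-independent alg₂ alg₁
        (All.tabulate λ χ′∈ → reflexive (_ , e∈ , χ′∈))) χ∈)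
    (Δ-independent alg₁ alg₂ (eqs⇒Δ alg₁ {E} {φ} {ψ} E⊨)))

record AlgebraizableLogic (ℓ : Level) : Set (lsuc (lsuc ℓ)) where
  field
    sig         : Signature ℓ
    logic       : Logic sig
    class       : Class sig
    pair        : TranslationPair sig
    algebraizes : Algebraizes logic class pair
  open Logic logic public
  open TranslationPair pair public

  F : Set ℓ
  F = Formula sig

  QV : Class sig
  QV = generatedQV class

open AlgebraizableLogic using (sig; logic; F; QV)

-- QV(a) is characterised as the unique quasivariety Q for which some pair (τ, Δ)
-- algebraizes a with respect to Q; the last three lemmas of this module show that
-- the quasivariety generated by the given class is this Q.
module _ {ℓ} (a : AlgebraizableLogic ℓ) where
  open AlgebraizableLogic a hiding (sig; logic; F; QV)
  open Algebraizes algebraizes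

  private
    class⊆QV : class ⊆ QV a
    class⊆QV KM q valid = valid _ KM

    toQV : ∀ {es : List (Equation (sig a) ℕ)} {e} →
           (_∈ˡ es) ⊨[ class ] e → (_∈ˡ es) ⊨[ QV a ] e
    toQV {es} {e} valid M qv v sat =
      qv (es , e) (λ N KN w sat′ → valid N KN w (All.lookup sat′)) v
         (All.tabulate sat)

    τlist : List (F a) → List (Equation (sig a) ℕ)
    τlist = concatMap τ[_]

    ∈τlist⁻ : ∀ Φ {e} → e ∈ˡ τlist Φ → e ∈ τ⟦ _∈ˡ Φ ⟧
    ∈τlist⁻ Φ e∈ = find (∈-concatMap⁻ τ[_] {xs = Φ} e∈)

    ∈τlist⁺ : ∀ Φ {e} → e ∈ τ⟦ _∈ˡ Φ ⟧ → e ∈ˡ τlist Φ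
    ∈τlist⁺ Φ (_ , γ∈ , e∈) = ∈-concatMap⁺ τ[_] {xs = Φ} (lose γ∈ e∈)

    toQVτ : ∀ Φ {e} → τ⟦ _∈ˡ Φ ⟧ ⊨[ class ] e → τ⟦ _∈ˡ Φ ⟧ ⊨[ QV a ] e
    toQVτ Φ {e} ⊨e M qv v sat = toQV {es = τlist Φ} {e = e}
      (λ N KN w sat′ → ⊨e N KN w λ e∈ → sat′ (∈τlist⁺ Φ e∈))
      M qv v λ e∈ → sat (∈τlist⁻ Φ e∈)

  QV-isQuasivariety : IsQuasivariety (QV a)
  QV-isQuasivariety = Validated class , (λ x → x) , (λ x → x)

  QV-algebraizes : Algebraizes (logic a) (QV a) (AlgebraizableLogic.pair a)
  QV-algebraizes = record
    { logic⇔eq = mk⇔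
        (λ Γ⊢φ → let (Φ , Φ⊆Γ , Φ⊢φ) = finitary Γ⊢φ in
          All.map
            (λ {e} ⊨e M qv v sat → toQVτ Φ {e} ⊨e M qv v
              λ (_ , γ∈ , e∈) → sat (_ , All.lookup Φ⊆Γ γ∈ , e∈))
            (Equivalence.to logic⇔eq Φ⊢φ))
        (λ ⊨τφ → Equivalence.from logic⇔eq
          (All.map (λ ⊨e M KM → ⊨e M (class⊆QV KM)) ⊨τφ))
    ; eq⊨τΔ = λ {φ} {ψ} {e} e∈ M qv v sat →
        toQV {es = (φ , ψ) ∷ []} {e = e}
          (λ N KN w sat′ → eq⊨τΔ e∈ N KN w λ { refl → sat′ (here refl) })
          M qv v λ { (here refl) → sat refl }
    ; τΔ⊨eq = λ {φ} {ψ} → toQVτ (φ Δ[] ψ) {φ , ψ} τΔ⊨eq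
    }

  QV-unique : ∀ {Q q} → IsQuasivariety Q → Algebraizes (logic a) Q q → Q ≐ QV a
  QV-unique {Q} (Ax , Q⊆ , ⊆Q) alg = Q⊆QV , QV⊆Q
    where
    Q⊆QV : Q ⊆ QV a
    Q⊆QV {M} QM (es , e) valid v sat =
      ⊨-independent algebraizes alg {_∈ˡ es} {proj₁ e} {proj₂ e}
        (λ N KN w sat′ → valid N KN w (All.tabulate sat′))
        M QM v (All.lookup sat)

    QV⊆Q : QV a ⊆ Q
    QV⊆Q {M} qv = ⊆Q λ (es , e) ax v sat → qv (es , e)
      (λ N KN w sat′ → ⊨-independent alg algebraizes {_∈ˡ es} {proj₁ e} {proj₂ e}
        (λ N′ QN′ w′ sat″ → Q⊆ QN′ (es , e) ax w′ (All.tabulate sat″))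
        N KN w (All.lookup sat′))
      v sat

-- Independent of the chosen Δ by Δ-independent.
IsLindenbaum : ∀ {ℓ} → AlgebraizableLogic ℓ → Set ℓ
IsLindenbaum a =
  ∀ φ ψ → (｛ φ ｝ ⊢ ψ × ｛ ψ ｝ ⊢ φ) ⇔ All (∅ ⊢_) (φ Δ[] ψ)
  where open AlgebraizableLogic a

record Category (o m e : Level) : Set (lsuc (o ⊔ m ⊔ e)) where
  infix  4 _≈_ _⇒_
  infixr 9 _∘_
  field
    Obj       : Set o
    _⇒_       : Obj → Obj → Set m
    _≈_       : ∀ {A B} → A ⇒ B → A ⇒ B → Set e
    id        : ∀ {A} → A ⇒ A
    _∘_       : ∀ {A B C} → B ⇒ C → A ⇒ B → A ⇒ C
    assoc     : ∀ {A B C D} {f : A ⇒ B} {g : B ⇒ C} {h : C ⇒ D} →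
                (h ∘ g) ∘ f ≈ h ∘ (g ∘ f)
    identityˡ : ∀ {A B} {f : A ⇒ B} → id ∘ f ≈ f
    identityʳ : ∀ {A B} {f : A ⇒ B} → f ∘ id ≈ f
    equiv     : ∀ {A B} → IsEquivalence (_≈_ {A} {B})
    ∘-resp-≈  : ∀ {A B C} {f f′ : B ⇒ C} {g g′ : A ⇒ B} →
                f ≈ f′ → g ≈ g′ → f ∘ g ≈ f′ ∘ g′

record Functor {o m e o′ m′ e′} (C : Category o m e) (D : Category o′ m′ e′) :
               Set (o ⊔ m ⊔ e ⊔ o′ ⊔ m′ ⊔ e′) where
  private
    module C = Category C
    module D = Category D
  field
    F₀       : C.Obj → D.Obj
    F₁       : ∀ {A B} → A C.⇒ B → F₀ A D.⇒ F₀ B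
    identity : ∀ {A} → F₁ (C.id {A}) D.≈ D.id
    homo     : ∀ {X Y Z} {f : X C.⇒ Y} {g : Y C.⇒ Z} →
               F₁ (g C.∘ f) D.≈ F₁ g D.∘ F₁ f
    F-resp-≈ : ∀ {A B} {f g : A C.⇒ B} → f C.≈ g → F₁ f D.≈ F₁ g

open Functor using (F₀; F₁)

idF : ∀ {o m e} {C : Category o m e} → Functor C C
idF {C = C} = record
  { F₀ = λ A → A ; F₁ = λ f → f
  ; identity = ≈-refl ; homo = ≈-refl ; F-resp-≈ = λ p → p }
  where
  open Category C
  ≈-refl : ∀ {A B} {f : A ⇒ B} → f ≈ f
  ≈-refl = IsEquivalence.refl equiv

infixr 9 _∘F_
_∘F_ : ∀ {o m e o′ m′ e′ o″ m″ e″} {C : Category o m e} {D : Category o′ m′ e′}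
         {E : Category o″ m″ e″} → Functor D E → Functor C D → Functor C E
_∘F_ {E = E} G H = record
  { F₀ = λ A → F₀ G (F₀ H A)
  ; F₁ = λ f → F₁ G (F₁ H f)
  ; identity = ≈-trans (Functor.F-resp-≈ G (Functor.identity H)) (Functor.identity G)
  ; homo = ≈-trans (Functor.F-resp-≈ G (Functor.homo H)) (Functor.homo G)
  ; F-resp-≈ = λ p → Functor.F-resp-≈ G (Functor.F-resp-≈ H p)
  }
  where
  open Category E
  ≈-trans : ∀ {A B} {f g k : A ⇒ B} → f ≈ g → g ≈ k → f ≈ k
  ≈-trans = IsEquivalence.trans equiv

record NaturalTransformation {o m e o′ m′ e′} {C : Category o m e}
         {D : Category o′ m′ e′} (G H : Functor C D) :
         Set (o ⊔ m ⊔ e ⊔ o′ ⊔ m′ ⊔ e′) where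
  private
    module C = Category C
    module D = Category D
  field
    η       : ∀ A → F₀ G A D.⇒ F₀ H A
    natural : ∀ {A B} (f : A C.⇒ B) → η B D.∘ F₁ G f D.≈ F₁ H f D.∘ η A

record LeftAdjoint {o m e o′ m′ e′} {C : Category o m e} {D : Category o′ m′ e′}
         (R : Functor D C) : Set (o ⊔ m ⊔ e ⊔ o′ ⊔ m′ ⊔ e′) where
  private
    module C = Category C
    module D = Category D
  field
    L      : Functor C D
    unit   : NaturalTransformation idF (R ∘F L)
    counit : NaturalTransformation (L ∘F R) idF
  module unit   = NaturalTransformation unit
  module counit = NaturalTransformation counit
  field
    zig : ∀ {A} → counit.η (F₀ L A) D.∘ F₁ L (unit.η A) D.≈ D.id
    zag : ∀ {B} → F₁ R (counit.η B) C.∘ unit.η (F₀ R B) C.≈ C.id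

  adjunct-injective : ∀ {A B} (f g : F₀ L A D.⇒ B) →
                      F₁ R f C.∘ unit.η A C.≈ F₁ R g C.∘ unit.η A → f D.≈ g
  adjunct-injective {A} {B} f g eq = ≈-trans (expand f) (≈-trans
      (D.∘-resp-≈ ≈-refl (Functor.F-resp-≈ L eq)) (≈-sym (expand g)))
    where
    ≈-refl : ∀ {X Y} {k : X D.⇒ Y} → k D.≈ k
    ≈-refl = IsEquivalence.refl D.equiv
    ≈-sym : ∀ {X Y} {k l : X D.⇒ Y} → k D.≈ l → l D.≈ k
    ≈-sym = IsEquivalence.sym D.equiv
    ≈-trans : ∀ {X Y} {k l m : X D.⇒ Y} → k D.≈ l → l D.≈ m → k D.≈ m
    ≈-trans = IsEquivalence.trans D.equiv

    expand : ∀ (k : F₀ L A D.⇒ B) →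
             k D.≈ counit.η B D.∘ F₁ L (F₁ R k C.∘ unit.η A)
    expand k = ≈-trans (≈-sym D.identityʳ)
      (≈-trans (D.∘-resp-≈ ≈-refl (≈-sym zig))
      (≈-trans (≈-sym D.assoc)
      (≈-trans (D.∘-resp-≈ (≈-sym (counit.natural k)) ≈-refl)
      (≈-trans D.assoc
               (D.∘-resp-≈ ≈-refl (≈-sym (Functor.homo L)))))))

QVCat : ∀ {ℓ} → AlgebraizableLogic ℓ → Category (lsuc ℓ) ℓ ℓ
QVCat a = record
  { Obj       = Σ[ M ∈ Algebra (sig a) ] QV a M
  ; _⇒_       = λ (M , _) (N , _) → Hom M N
  ; _≈_       = λ {_} {(N , _)} f g → ∀ x → Algebra._≈_ N (fun f x) (fun g x)
  ; id        = idHom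
  ; _∘_       = compHom
  ; assoc     = λ {_} {_} {_} {(P , _)} _ → Algebra.≈-refl P
  ; identityˡ = λ {_} {(N , _)} _ → Algebra.≈-refl N
  ; identityʳ = λ {_} {(N , _)} _ → Algebra.≈-refl N
  ; equiv     = λ {_} {(N , _)} → record
      { refl  = λ _ → Algebra.≈-refl N
      ; sym   = λ p x → Algebra.≈-sym N (p x)
      ; trans = λ p q x → Algebra.≈-trans N (p x) (q x) }
  ; ∘-resp-≈  = λ {_} {_} {(P , _)} {f} p q x →
      Algebra.≈-trans P (Hom.fun-cong f (q x)) (p _)
  }

module _ {ℓ} (a : AlgebraizableLogic ℓ) where
  open AlgebraizableLogic a hiding (sig; logic; F; QV)

  module _ (T : Pred (F a) ℓ) where

    infix 4 _≈Δ_
    _≈Δ_ : F a → F a → Set ℓ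
    φ ≈Δ ψ = All (T ⊢_) (φ Δ[] ψ)

    private
      to : ∀ {φ ψ} → φ ≈Δ ψ → τ⟦ T ⟧ ⊨[ class ] (φ , ψ)
      to = ⊢Δ⇒τ⊨ algebraizes

      from : ∀ {φ ψ} → τ⟦ T ⟧ ⊨[ class ] (φ , ψ) → φ ≈Δ ψ
      from = τ⊨⇒⊢Δ algebraizes

      evals-≈ : ∀ {n} {φs ψs : Vec (F a) n} → Pointwise _≈Δ_ φs ψs →
                ∀ M → class M → ∀ v → (∀ {e} → e ∈ τ⟦ T ⟧ → Satisfies M v e) →
                Pointwise (Algebra._≈_ M) (Algebra.evals M v φs)
                                          (Algebra.evals M v ψs)
      evals-≈ []       M KM v sat = []
      evals-≈ (p ∷ ps) M KM v sat = to p M KM v sat ∷ evals-≈ ps M KM v sat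

    -- F(Σ) modulo φ ~ ψ :⇔ T ⊢ φ Δ ψ.
    quotient : Algebra (sig a)
    quotient = record
      { setoid = record
          { Carrier       = F a
          ; _≈_           = _≈Δ_
          ; isEquivalence = record
              { refl  = from λ M _ _ _ → Algebra.≈-refl M
              ; sym   = λ {φ} {ψ} p → from {ψ} {φ} λ M KM v sat →
                  Algebra.≈-sym M (to p M KM v sat)
              ; trans = λ {φ} {_} {ψ} p q → from {φ} {ψ} λ M KM v sat →
                  Algebra.≈-trans M (to p M KM v sat) (to q M KM v sat)
              }
          }
      ; interp      = op
      ; interp-cong = λ c {φs} {ψs} ps → from {op c φs} {op c ψs}
          λ M KM v sat → Algebra.interp-cong M c (evals-≈ ps M KM v sat)
      }

    eval-quotient : ∀ {V : Set} (σ : V → F a) t →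
                    Algebra.eval quotient σ t ≡ sub σ t
    evals-quotient : ∀ {V : Set} (σ : V → F a) {n} (ts : Vec (Term (sig a) V) n) →
                     Algebra.evals quotient σ ts ≡ subs σ ts

    eval-quotient σ (var x)   = refl
    eval-quotient σ (op c ts) = cong (op c) (evals-quotient σ ts)

    evals-quotient σ []       = refl
    evals-quotient σ (t ∷ ts) = cong₂ _∷_ (eval-quotient σ t) (evals-quotient σ ts)

    quotient∈QV : QV a quotient
    quotient∈QV (es , (s , t)) valid σ sat
      rewrite eval-quotient σ s | eval-quotient σ t =
      from {sub σ s} {sub σ t} λ M KM v sat′ →
        let open Algebra M in
        ≈-trans (≈-reflexive (eval-sub v σ s))
        (≈-trans
          (valid M KM (λ x → eval v (σ x)) (All.map (λ {e} → transfer M KM v sat′ {e}) sat))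
          (≈-reflexive (sym (eval-sub v σ t))))
      where
      transfer : ∀ M → class M → ∀ v → (∀ {e} → e ∈ τ⟦ T ⟧ → Satisfies M v e) →
                 ∀ {e} → Satisfies quotient σ e →
                 Satisfies M (λ x → Algebra.eval M v (σ x)) e
      transfer M KM v sat′ {s′ , t′} s≈t
        rewrite eval-quotient σ s′ | eval-quotient σ t′ =
        ≈-trans (≈-reflexive (sym (eval-sub v σ s′)))
        (≈-trans (to s≈t M KM v sat′) (≈-reflexive (eval-sub v σ t′)))
        where open Algebra M

  F/Δ : Category.Obj (QVCat a)
  F/Δ = quotient ∅ , quotient∈QV ∅

  free-hom : ((N , _) : Category.Obj (QVCat a)) → (ℕ → Algebra.Carrier N) →
             Hom (quotient ∅) N
  free-hom (N , N∈QV) v = record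
    { fun      = eval v
    ; fun-cong = λ {φ} {ψ} p →
        ⊢Δ⇒τ⊨ (QV-algebraizes a) {∅} {φ} {ψ} p N N∈QV v λ { (_ , () , _) }
    ; fun-op   = λ c as → ≈-reflexive (cong (interp c) (evals≡map as))
    }
    where
    open Algebra N
    evals≡map : ∀ {n} (ts : Vec (F a) n) → evals v ts ≡ map (eval v) ts
    evals≡map []       = refl
    evals≡map (t ∷ ts) = cong (eval v t ∷_) (evals≡map ts)

  free-hom-unique : ((N , _) : Category.Obj (QVCat a)) (f g : Hom (quotient ∅) N) →
                    (∀ x → Algebra._≈_ N (fun f (var x)) (fun g (var x))) →
                    ∀ φ → Algebra._≈_ N (fun f φ) (fun g φ)
  free-hom-unique (N , _) f g eq φ = begin
      fun f φ                              ≈⟨ Hom.fun-cong f (reify φ) ⟩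
      fun f (Algebra.eval (quotient ∅) var φ)  ≈⟨ Hom.fun-eval f var φ ⟩
      eval (λ x → fun f (var x)) φ         ≈⟨ eval-cong eq φ ⟩
      eval (λ x → fun g (var x)) φ         ≈⟨ Hom.fun-eval g var φ ⟨
      fun g (Algebra.eval (quotient ∅) var φ)  ≈⟨ Hom.fun-cong g (reify φ) ⟨
      fun g φ                              ∎
    where
    open Algebra N
    open SetoidReasoning setoid
    sub-var : ∀ (t : F a) → sub var t ≡ t
    subs-var : ∀ {n} (ts : Vec (F a) n) → subs var ts ≡ ts
    sub-var (var x)   = refl
    sub-var (op c ts) = cong (op c) (subs-var ts)
    subs-var []       = refl
    subs-var (t ∷ ts) = cong₂ _∷_ (sub-var t) (subs-var ts)

    reify : ∀ φ → Algebra._≈_ (quotient ∅) φ (Algebra.eval (quotient ∅) var φ)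
    reify φ = Algebra.≈-reflexive (quotient ∅)
      (sym (trans (eval-quotient ∅ var φ) (sub-var φ)))

extPair : ∀ {ℓ} {S S′ : Signature ℓ} → FlexibleMorphism S S′ →
          TranslationPair S → TranslationPair S′
extPair f p = record
  { τ = List.map (λ (ε , δ) → ext f ε , ext f δ) τ
  ; Δ = List.map (ext f) Δ }
  where open TranslationPair p

-- Af a a′ is the hom-set 𝒜_f(a, a′).
record Af {ℓ} (a a′ : AlgebraizableLogic ℓ) : Set (lsuc (lsuc ℓ)) where
  field
    mor            : FlexibleMorphism (sig a) (sig a′)
    isTranslation  : IsTranslation (logic a) (logic a′) mor
    preservesPairs : ∀ p → IsAlgebraizingPair (logic a) p →
                     IsAlgebraizingPair (logic a′) (extPair mor p)

module _ {ℓ} {a a′ : AlgebraizableLogic ℓ} (h : Af a a′) where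
  open Af h
  private
    module a  = AlgebraizableLogic a
    module a′ = AlgebraizableLogic a′
    S  = sig a
    S′ = sig a′

    ȟ : ∀ {V} → Term S V → Term S′ V
    ȟ = ext mor

    hpair : TranslationPair S′
    hpair = extPair mor a.pair

    module hp = TranslationPair hpair

    halg : IsAlgebraizingPair (logic a′) hpair
    halg = preservesPairs a.pair (a.class , a.algebraizes)

    ext-instance : ∀ (φ ψ : Formula S) (δ : Term S (Fin 2)) →
                   ȟ (sub (lookup (φ ∷ ψ ∷ [])) δ) ≡
                   sub (lookup (ȟ φ ∷ ȟ ψ ∷ [])) (ȟ δ)
    ext-instance φ ψ δ = trans (ext-sub mor _ δ) (sub-cong pointwise (ȟ δ))
      where
      pointwise : ∀ i → ȟ (lookup (φ ∷ ψ ∷ []) i) ≡ lookup (ȟ φ ∷ ȟ ψ ∷ []) i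
      pointwise zero       = refl
      pointwise (suc zero) = refl

    ext-Δ⁺ : ∀ {φ ψ χ} → χ ∈ˡ (φ a.Δ[] ψ) → ȟ χ ∈ˡ (ȟ φ hp.Δ[] ȟ ψ)
    ext-Δ⁺ {φ} {ψ} χ∈ with ∈-map⁻ _ χ∈
    ... | δ , δ∈ , refl = subst (_∈ˡ (ȟ φ hp.Δ[] ȟ ψ)) (sym (ext-instance φ ψ δ))
                                (∈-map⁺ _ (∈-map⁺ ȟ δ∈))

    ext-Δ⁻ : ∀ {φ ψ χ′} → χ′ ∈ˡ (ȟ φ hp.Δ[] ȟ ψ) →
             ∃[ χ ] χ ∈ˡ (φ a.Δ[] ψ) × χ′ ≡ ȟ χ
    ext-Δ⁻ {φ} {ψ} χ′∈ with ∈-map⁻ _ χ′∈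
    ... | _ , hδ∈ , refl with ∈-map⁻ ȟ hδ∈
    ... | δ , δ∈ , refl = _ , ∈-map⁺ _ δ∈ , sym (ext-instance φ ψ δ)

    ext-⊢Δ : ∀ {T φ ψ} → All (T a.⊢_) (φ a.Δ[] ψ) →
             All (image (ȟ {ℕ}) T a′.⊢_) (ȟ φ hp.Δ[] ȟ ψ)
    ext-⊢Δ {T} T⊢ = All.tabulate λ χ′∈ → let (_ , χ∈ , eq) = ext-Δ⁻ χ′∈ in
      subst (image (ȟ {ℕ}) T a′.⊢_) (sym eq) (isTranslation (All.lookup T⊢ χ∈))

    ext-⊨ : ∀ {E φ ψ} → E ⊨[ a.class ] (φ , ψ) →
            image (λ (s , t) → ȟ s , ȟ t) E ⊨[ a′.class ] (ȟ φ , ȟ ψ)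
    ext-⊨ {E} {φ} {ψ} E⊨ =
      ⊨-independent (proj₂ halg) a′.algebraizes {hE} {ȟ φ} {ȟ ψ}
        (Δ⇒eqs (proj₂ halg) {hE} {ȟ φ} {ȟ ψ}
          (All.map
            (a′.monotone λ { (_ , (e , e∈ , χ∈) , refl) →
              _ , (e , e∈ , refl) , ext-Δ⁺ χ∈ })
            (ext-⊢Δ (eqs⇒Δ a.algebraizes {E} {φ} {ψ} E⊨))))
      where
      hE : Pred (Equation S′ ℕ) ℓ
      hE = image (λ (s , t) → ȟ s , ȟ t) E

    sat-ext⁺ : ∀ N (v : ℕ → Algebra.Carrier N) {s t} → Satisfies (mor ⋆ N) v (s , t) →
               Satisfies N v (ȟ s , ȟ t)
    sat-ext⁺ N v {s} {t} p = ≈-trans (eval-ext mor N v s)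
      (≈-trans p (≈-sym (eval-ext mor N v t)))
      where open Algebra N

    sat-ext⁻ : ∀ N (v : ℕ → Algebra.Carrier N) {s t} → Satisfies N v (ȟ s , ȟ t) →
               Satisfies (mor ⋆ N) v (s , t)
    sat-ext⁻ N v {s} {t} p = ≈-trans (≈-sym (eval-ext mor N v s))
      (≈-trans p (eval-ext mor N v t))
      where open Algebra N

  ⋆∈QV : ∀ {N} → QV a′ N → QV a (mor ⋆ N)
  ⋆∈QV {N} N∈QV (es , (s , t)) valid v sat = sat-ext⁻ N v {s} {t}
    (N∈QV (List.map both es , (ȟ s , ȟ t))
      (λ M KM w sat′ →
        ext-⊨ {_∈ˡ es} {s} {t}
          (λ P KP u sat″ → valid P KP u (All.tabulate sat″)) M KM w
          λ { (_ , e∈ , refl) → All.lookup sat′ (∈-map⁺ both e∈) })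
      v
      (All.tabulate λ e∈ → mapped (∈-map⁻ both e∈)))
    where
    both : Equation S ℕ → Equation S′ ℕ
    both (s , t) = ȟ s , ȟ t

    mapped : ∀ {e′} → (∃[ e ] e ∈ˡ es × e′ ≡ both e) → Satisfies N v e′
    mapped ((s′ , t′) , e∈ , refl) = sat-ext⁺ N v {s′} {t′} (All.lookup sat e∈)

  _⋆↾ : Functor (QVCat a′) (QVCat a)
  _⋆↾ = record
    { F₀       = λ (N , N∈QV) → mor ⋆ N , ⋆∈QV {N} N∈QV
    ; F₁       = ⋆-hom mor
    ; identity = λ {(N , _)} _ → Algebra.≈-refl N
    ; homo     = λ {_} {_} {(P , _)} _ → Algebra.≈-refl P
    ; F-resp-≈ = λ p → p
    }

  -- [θ] ↦ [ȟ(θ)]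
  ext-hom : Category._⇒_ (QVCat a) (F/Δ a) (F₀ _⋆↾ (F/Δ a′))
  ext-hom = record
    { fun      = ȟ
    ; fun-cong = λ p → Δ-independent (proj₂ halg) a′.algebraizes
        (All.map (a′.monotone λ { (_ , () , _) }) (ext-⊢Δ p))
    ; fun-op   = λ c φs → Algebra.≈-reflexive (quotient a′ ∅)
        (trans (cong (λ us → sub (lookup us) (proj₁ (mor c))) (exts≡map mor φs))
               (sym (eval-quotient a′ ∅ _ (proj₁ (mor c)))))
    }

  -- For an arbitrary left adjoint, L_h(F(Σ)/Δ) is F(Σ′)/Δ′ only up to the
  -- isomorphism ι, determined by its compatibility ι-unit with the units.
  module _ (A : LeftAdjoint _⋆↾) where
    open LeftAdjoint A
    private
      module C  = Category (QVCat a)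
      module C′ = Category (QVCat a′)
      LF : C′.Obj
      LF = F₀ L (F/Δ a)
      module LF = Algebra (proj₁ LF)

    ι : F/Δ a′ C′.⇒ LF
    ι = free-hom a′ LF (λ x → fun (unit.η (F/Δ a)) (var x))

    ι⁻¹ : LF C′.⇒ F/Δ a′
    ι⁻¹ = compHom (counit.η (F/Δ a′)) (F₁ L ext-hom)

    ι-unit : ∀ θ → fun ι (ȟ θ) LF.≈ fun (unit.η (F/Δ a)) θ
    ι-unit = free-hom-unique a (F₀ _⋆↾ LF)
      (compHom (⋆-hom mor ι) ext-hom) (unit.η (F/Δ a)) (λ x → LF.≈-refl)

    ι⁻¹-unit : ∀ θ → Algebra._≈_ (quotient a′ ∅)
                       (fun ι⁻¹ (fun (unit.η (F/Δ a)) θ)) (ȟ θ)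
    ι⁻¹-unit θ = Q.≈-trans
        (Hom.fun-cong (counit.η (F/Δ a′)) (LRF.≈-sym (unit.natural ext-hom θ)))
        (zag {F/Δ a′} (ȟ θ))
      where
      module Q = Algebra (quotient a′ ∅)
      module LRF = Algebra (proj₁ (F₀ L (F₀ _⋆↾ (F/Δ a′))))

    ι⁻¹∘ι : ∀ θ′ → Algebra._≈_ (quotient a′ ∅) (fun ι⁻¹ (fun ι θ′)) θ′
    ι⁻¹∘ι = free-hom-unique a′ (F/Δ a′) (compHom ι⁻¹ ι) idHom (λ x → ι⁻¹-unit (var x))

    ι∘ι⁻¹ : ∀ x → fun ι (fun ι⁻¹ x) LF.≈ x
    ι∘ι⁻¹ = adjunct-injective {F/Δ a} {LF}
      (compHom ι ι⁻¹) idHom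
      λ θ → LF.≈-trans (Hom.fun-cong ι (ι⁻¹-unit θ)) (ι-unit θ)

-- L_h is any left adjoint of h⋆↾; ρ̄X is the component of ρ̄ at F(Σ)/Δ precomposed
-- with the identification ι of F(Σ′)/Δ′ with L_h(F(Σ)/Δ).
record GlivenkoContext {ℓ} (a a′ : AlgebraizableLogic ℓ) : Set (lsuc (lsuc ℓ)) where
  field
    h           : Af a a′
    leftAdjoint : LeftAdjoint (h ⋆↾)
  open LeftAdjoint leftAdjoint using (L; unit; module unit)
  open Category (QVCat a)

  R-L : Obj → Obj
  R-L M = F₀ (h ⋆↾) (F₀ L M)

  field
    ρ̄       : NaturalTransformation ((h ⋆↾) ∘F L) idF
  open NaturalTransformation ρ̄ using () renaming (η to ρ̄-at) public
  field
    section : ∀ M y → Algebra._≈_ (proj₁ (R-L M))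
                        (fun (unit.η M) (fun (ρ̄-at M) y)) y

  ρ̄X : F₀ (h ⋆↾) (F/Δ a′) ⇒ F/Δ a
  ρ̄X = compHom (ρ̄-at (F/Δ a)) (⋆-hom (Af.mor h) (ι h leftAdjoint))

  IsLifting : (F a′ → F a) → Set ℓ
  IsLifting ρX = ∀ θ′ → Algebra._≈_ (proj₁ (F/Δ a)) (ρX θ′) (fun ρ̄X θ′)

{-# OPTIONS --safe #-}
module Submission where

-- An element x of an algebra is called designated when ε(x) ≈ δ(x) for every (ε, δ) in τ.
-- In the quotient of F(Σ) by a set T of formulas the designated elements are those φ with
-- T ⊢ φ, and homomorphisms preserve designation.
--
-- If Γ′ ⊢′ φ′, put T = ρX[Γ′] and let M be the quotient of F(Σ) by T, with projection π and
-- g = L(π) : F(Σ′)/Δ′ → L(M).  The unit at M sends π(ρX θ′) to g(θ′) because ρ̄ is a section,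
-- so each g(γ′) is designated; as L(M) lies in QV(a′), so is g(φ′).  By naturality ρ̄ sends
-- g(φ′) back to π(ρX φ′), which is therefore designated too, that is, T ⊢ ρX φ′.
--
-- Conversely, ⊢′ ȟ(ρX θ′) Δ′ θ′ because ρ̄ is a section, so a derivation of ρX φ′ from ρX[Γ′]
-- is turned by h into one of φ′ from Γ′.

open import Defs
open import Data.Fin using (Fin)
open import Data.List.Relation.Unary.All using (All)
import Data.List.Relation.Unary.All as All
import Data.List.Relation.Unary.All.Properties as All using (map⁺; map⁻)
open import Data.Product using (_×_; _,_; proj₁; proj₂)
open import Data.Vec.Properties using (map-id)
open import Function.Bundles using (_⇔_; mk⇔; Equivalence)
open import Relation.Binary.PropositionalEquality using (refl; sym; cong)
import Relation.Binary.Reasoning.Setoid as SetoidReasoning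
open import Relation.Unary using (Pred; _∈_; ｛_｝)
open import Relation.Unary.Polymorphic using (∅)
open AlgebraizableLogic using (F; _⊢_)
open GlivenkoContext using (IsLifting)
open Hom using (fun)
open Functor using (F₀; F₁)

module _ {ℓ} {S : Signature ℓ} where

  Designated : TranslationPair S → (M : Algebra S) → Algebra.Carrier M → Set ℓ
  Designated p M x = All (λ (ε , δ) → eval (λ _ → x) ε ≈ eval (λ _ → x) δ) τ
    where
    open Algebra M
    open TranslationPair p

  designated-resp-≈ : ∀ p (M : Algebra S) {x y} → Algebra._≈_ M x y →
                      Designated p M x → Designated p M y
  designated-resp-≈ p M x≈y = All.map λ {(ε , δ)} ε≈δ →
    ≈-trans (≈-sym (eval-cong (λ _ → x≈y) ε)) (≈-trans ε≈δ (eval-cong (λ _ → x≈y) δ))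
    where open Algebra M

  hom-designated : ∀ p {M N : Algebra S} (f : Hom M N) {x} →
                   Designated p M x → Designated p N (fun f x)
  hom-designated p {N = N} f = All.map λ {(ε , δ)} ε≈δ →
    ≈-trans (≈-sym (Hom.fun-eval f _ ε))
      (≈-trans (Hom.fun-cong f ε≈δ) (Hom.fun-eval f _ δ))
    where open Algebra N

  designated⇔satisfies : ∀ p (M : Algebra S) v {φ} →
    Designated p M (Algebra.eval M v φ) ⇔ All (Satisfies M v) (TranslationPair.τ[_] p φ)
  designated⇔satisfies p M v {φ} = mk⇔
    (λ des → All.map⁺ (All.map (λ {(ε , δ)} → expand ε δ) des))
    (λ sat → All.map (λ {(ε , δ)} → reduce ε δ) (All.map⁻ sat))
    where
    open Algebra M
    reduce : ∀ ε δ → eval v (sub (λ _ → φ) ε) ≈ eval v (sub (λ _ → φ) δ) →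
             eval {V = Fin 1} (λ _ → eval v φ) ε ≈ eval (λ _ → eval v φ) δ
    reduce ε δ p rewrite eval-sub v (λ _ → φ) ε | eval-sub v (λ _ → φ) δ = p
    expand : ∀ ε δ → eval {V = Fin 1} (λ _ → eval v φ) ε ≈ eval (λ _ → eval v φ) δ →
             eval v (sub (λ _ → φ) ε) ≈ eval v (sub (λ _ → φ) δ)
    expand ε δ p rewrite eval-sub v (λ _ → φ) ε | eval-sub v (λ _ → φ) δ = p

  designated-sound : {a : Logic S} {K : Class S} {p : TranslationPair S} →
    Algebraizes a K p → (M : Algebra S) → K M → ∀ v {Γ φ} → Logic._⊢_ a Γ φ →
    (∀ {γ} → γ ∈ Γ → Designated p M (Algebra.eval M v γ)) →
    Designated p M (Algebra.eval M v φ)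
  designated-sound {p = p} alg M M∈K v {φ = φ} Γ⊢φ des =
    Equivalence.from (designated⇔satisfies p M v {φ})
      (All.map (λ ⊨e → ⊨e M M∈K v λ { (γ , γ∈ , e∈) →
          All.lookup {P = Satisfies M v}
            (Equivalence.to (designated⇔satisfies p M v {γ}) (des γ∈)) e∈ })
        (Equivalence.to (Algebraizes.logic⇔eq alg) Γ⊢φ))

module _ {ℓ} {S S′ : Signature ℓ} (f : FlexibleMorphism S S′) (p : TranslationPair S)
         (N : Algebra S′) {x : Algebra.Carrier N} where
  open Algebra N

  -- `f ⋆ N` has the carrier of `N`, and by `eval-ext` a term has there the value of its translation
  -- in `N`. Designation can thus be moved between the two signatures.
  ⋆-designated : Designated p (f ⋆ N) x ⇔ Designated (extPair f p) N x
  ⋆-designated = mk⇔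
    (λ des → All.map⁺ (All.map (λ {(ε , δ)} ε≈δ →
      ≈-trans (eval-ext f N _ ε) (≈-trans ε≈δ (≈-sym (eval-ext f N _ δ)))) des))
    (λ des → All.map (λ {(ε , δ)} ε≈δ →
      ≈-trans (≈-sym (eval-ext f N _ ε)) (≈-trans ε≈δ (eval-ext f N _ δ))) (All.map⁻ des))

module _ {ℓ} (a : AlgebraizableLogic ℓ) where
  open AlgebraizableLogic a hiding (_⊢_; F)

  -- The class `K` that comes with `q` may differ from `class`, but by uniqueness both generate the
  -- same quasivariety, so `M` also lies in the one generated by `K`.
  pair-sound-for-QV : ∀ {q} → IsAlgebraizingPair logic q → (M : Algebra sig) → QV M →
    ∀ v {Γ φ} → _⊢_ a Γ φ →
    (∀ {γ} → γ ∈ Γ → Designated q M (Algebra.eval M v γ)) →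
    Designated q M (Algebra.eval M v φ)
  pair-sound-for-QV {q} (K , alg) M M∈QV v = designated-sound (QV-algebraizes b) M
    (proj₂ (QV-unique a (QV-isQuasivariety b) (QV-algebraizes b)) {M} M∈QV) v
    where
    b : AlgebraizableLogic ℓ
    b = record { sig = sig ; logic = logic ; class = K ; pair = q ; algebraizes = alg }

  module _ (T : Pred (F a) ℓ) where

    -- Equality in the quotient is consequence from `τ⟦ T ⟧`, so designation of `φ` says that
    -- `τ⟦ T ⟧` entails `τ[ φ ]`.
    quotient-designated : ∀ {φ} → _⊢_ a T φ ⇔ Designated pair (quotient a T) φ
    quotient-designated {φ} = mk⇔
      (λ T⊢φ → All.map (λ {(ε , δ)} → reduce ε δ)
        (All.map⁻ (All.map {Q = λ (s , t) → s ≈ t}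
          (λ {(s , t)} → τ⊨⇒⊢Δ algebraizes {T} {s} {t})
          (Equivalence.to logic⇔eq T⊢φ))))
      (λ des → Equivalence.from logic⇔eq
        (All.map {P = λ (s , t) → s ≈ t} (λ {(s , t)} → ⊢Δ⇒τ⊨ algebraizes {T} {s} {t})
          (All.map⁺ (All.map (λ {(ε , δ)} → expand ε δ) des))))
      where
      open Algebraizes algebraizes
      open Algebra (quotient a T)
      reduce : ∀ ε δ → sub (λ _ → φ) ε ≈ sub (λ _ → φ) δ →
               eval (λ _ → φ) ε ≈ eval (λ _ → φ) δ
      reduce ε δ p rewrite eval-quotient a T (λ _ → φ) ε | eval-quotient a T (λ _ → φ) δ = p
      expand : ∀ ε δ → eval (λ _ → φ) ε ≈ eval (λ _ → φ) δ →
               sub (λ _ → φ) ε ≈ sub (λ _ → φ) δ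
      expand ε δ p rewrite eval-quotient a T (λ _ → φ) ε | eval-quotient a T (λ _ → φ) δ = p

    projection : Hom (quotient a ∅) (quotient a T)
    projection = record
      { fun      = λ φ → φ
      ; fun-cong = All.map (monotone λ ())
      ; fun-op   = λ c φs → Algebra.≈-reflexive (quotient a T) (cong (op c) (sym (map-id φs)))
      }

module _ {ℓ} {a a′ : AlgebraizableLogic ℓ} (G : GlivenkoContext a a′)
         {ρX : F a′ → F a} (lifting : IsLifting G ρX) where
  open GlivenkoContext G hiding (IsLifting)
  open LeftAdjoint leftAdjoint using (L; module unit)
  open Af h using (mor; isTranslation; preservesPairs)
  private
    module a  = AlgebraizableLogic a
    module a′ = AlgebraizableLogic a′
    module Q′ = Algebra (quotient a′ ∅)
    module LF = Algebra (proj₁ (F₀ L (F/Δ a)))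

  ext-lifting : ∀ θ′ → ext mor (ρX θ′) Q′.≈ θ′
  -- `ι` has the left inverse `ι⁻¹`, so it suffices to compare the images under `ι`.
  ext-lifting θ′ = Q′.≈-trans (Q′.≈-sym (ι⁻¹∘ι h leftAdjoint (ext mor (ρX θ′))))
    (Q′.≈-trans (Hom.fun-cong (ι⁻¹ h leftAdjoint) ι-ext-lifting) (ι⁻¹∘ι h leftAdjoint θ′))
    where
    open SetoidReasoning LF.setoid
    ι-ext-lifting : fun (ι h leftAdjoint) (ext mor (ρX θ′)) LF.≈ fun (ι h leftAdjoint) θ′
    ι-ext-lifting = begin
      fun (ι h leftAdjoint) (ext mor (ρX θ′))  ≈⟨ ι-unit h leftAdjoint (ρX θ′) ⟩
      fun (unit.η (F/Δ a)) (ρX θ′)             ≈⟨ Hom.fun-cong (unit.η (F/Δ a)) (lifting θ′) ⟩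
      -- By definition `ρ̄X` is `ρ̄-at (F/Δ a)` after `ι`, and the unit undoes the former.
      fun (unit.η (F/Δ a)) (fun ρ̄X θ′)         ≈⟨ section (F/Δ a) _ ⟩
      fun (ι h leftAdjoint) θ′                 ∎

  -- The Lindenbaum property turns `ext-lifting` into interderivability of `ext mor (ρX θ′)` and
  -- `θ′`; cuts then replace the translated premises and conclusion by the original ones.
  reflects : IsLindenbaum a′ → ∀ {Γ′ φ′} → image ρX Γ′ a.⊢ ρX φ′ → Γ′ a′.⊢ φ′
  reflects lind′ {Γ′} {φ′} ρΓ⊢ρφ = a′.cut
    (λ { refl → a′.cut
      (λ { (_ , (γ′ , γ′∈ , refl) , refl) →
             a′.cut (λ { refl → a′.reflexive γ′∈ }) (proj₂ (interderivable γ′)) })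
      (isTranslation ρΓ⊢ρφ) })
    (proj₁ (interderivable φ′))
    where
    interderivable : ∀ θ′ → ｛ ext mor (ρX θ′) ｝ a′.⊢ θ′ × ｛ θ′ ｝ a′.⊢ ext mor (ρX θ′)
    interderivable θ′ = Equivalence.from (lind′ (ext mor (ρX θ′)) θ′) (ext-lifting θ′)

  preserves : ∀ {Γ′ φ′} → Γ′ a′.⊢ φ′ → image ρX Γ′ a.⊢ ρX φ′
  preserves {Γ′} {φ′} Γ′⊢φ′ = Equivalence.from (quotient-designated a T)
    (designated-resp-≈ a.pair M.algebra (M.≈-sym (lifting-in-M φ′))
      (hom-designated a.pair (ρ̄-at M.obj)
        (Equivalence.from (⋆-designated mor a.pair LM)
          -- Soundness in `LM` is needed for the translated pair, not for the pair chosen with `a′`;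
          -- it is available because `h` preserves algebraizing pairs.
          (pair-sound-for-QV a′ (preservesPairs a.pair (a.class , a.algebraizes))
            LM (proj₂ (F₀ L M.obj)) v Γ′⊢φ′
            λ γ′∈ → Equivalence.to (⋆-designated mor a.pair LM) (premise γ′∈)))))
    where
    T : Pred (F a) ℓ
    T = image ρX Γ′

    module M where
      algebra = quotient a T
      obj = algebra , quotient∈QV a T
      open Algebra algebra public

    LM = proj₁ (F₀ L M.obj)
    module LM = Algebra LM

    Lπ : Hom (proj₁ (F₀ L (F/Δ a))) LM
    Lπ = F₁ L {F/Δ a} {M.obj} (projection a T)

    -- With this valuation, `LM.eval v θ′` is the image of `θ′` under `Lπ` after `ι`, up to equality
    -- in `LM`: the element g(θ′) of the overview.
    v = λ x → fun Lπ (fun (unit.η (F/Δ a)) (var x))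

    lifting-in-M : ∀ θ′ → ρX θ′ M.≈ fun (ρ̄-at M.obj) (LM.eval v θ′)
    lifting-in-M θ′ = begin
      ρX θ′                               ≈⟨ Hom.fun-cong (projection a T) (lifting θ′) ⟩
      fun ρ̄X θ′                           ≈⟨ natural {F/Δ a} {M.obj} (projection a T) ιθ′ ⟨
      fun (ρ̄-at M.obj) (fun Lπ ιθ′)       ≈⟨ Hom.fun-cong (ρ̄-at M.obj) (Hom.fun-eval Lπ _ θ′) ⟩
      fun (ρ̄-at M.obj) (LM.eval v θ′)     ∎
      where
      open NaturalTransformation ρ̄ using (natural)
      open SetoidReasoning M.setoid
      ιθ′ = fun (ι h leftAdjoint) θ′

    premise : ∀ {γ′} → γ′ ∈ Γ′ → Designated a.pair (mor ⋆ LM) (LM.eval v γ′)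
    premise {γ′} γ′∈ = designated-resp-≈ a.pair (mor ⋆ LM)
      -- The unit sends `ρX γ′` to `LM.eval v γ′`, since `ρX γ′` is the image of that element under
      -- `ρ̄-at M.obj`.
      (LM.≈-trans (Hom.fun-cong (unit.η M.obj) (lifting-in-M γ′)) (section M.obj _))
      (hom-designated a.pair (unit.η M.obj)
        (Equivalence.to (quotient-designated a T) (a.reflexive (γ′ , γ′∈ , refl))))

corollary4p13 : ∀ {ℓ} (a a′ : AlgebraizableLogic ℓ) →
    IsLindenbaum a → IsLindenbaum a′ →
    (G : GlivenkoContext a a′) →
    (ρX : F a′ → F a) → IsLifting G ρX →
    (Γ′ : Pred (F a′) ℓ) (φ′ : F a′) →
    (_⊢_ a (image ρX Γ′) (ρX φ′)) ⇔ (_⊢_ a′ Γ′ φ′)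
corollary4p13 a a′ _ lind′ G ρX lifting Γ′ φ′ =
  mk⇔ (reflects G lifting lind′) (preserves G lifting)
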